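{- Let $S$ be a non-empty finite reverse-factor-free set of strings of total length $n$, and let $k_{\min}$ be the length of a shortest string that contains, for every $s\in S$, $s$ or $s^R$ as a factor. Let $w$ be an output of the algorithm Greedy-R on $S$ (for any way of breaking ties). Then $$n-|w|\;\ge\;\tfrac12\,(n-k_{\min}),$$ i.e., Greedy-R has compression ratio $\tfrac12$.
   Context: For strings $x,y$, $\mathit{ov}(x,y)$ is the length of the longest suffix of $x$ that is also a prefix of $y$; $\mathrm{pref}(x,y)$ is $x$ with its suffix of length $\mathit{ov}(x,y)$ removed, and $x\otimes y=\mathrm{pref}(x,y)\,y$. $x^R$ denotes the reversal of $x$. For a set $X$ of strings, $X^R=\{x^R: x\in X\}$ and $\widetilde{X}=X\cup X^R$. A set $X$ is reverse-factor-free if there are no distinct $x,y\in X$ such that $x$ is a factor of $y$ or of $y^R$. The procedure Make-Reverse-Factor-Free$(X)$ repeatedly removes from the current set a string $x$ for which some other string $y\neq x$ of the current set has $x$ as a factor of $y$ or of $y^R$, until no such string remains (on a reverse-factor-free set it does nothing). Algorithm Greedy-R$(S)$: first set $S:=$ Make-Reverse-Factor-Free$(S)$. Then, while $|S|>1$: among all pairs $(u,v)$ with $u,v\in\widetilde{S}$ and $u\notin\{v,v^R\}$, choose one with maximal $\mathit{ov}(u,v)$ (ties broken arbitrarily); set $S:=S\cup\{u\otimes v\}$ and then remove from $S$ all of $u,v,u^R,v^R$ that belong to $S$. Return the only element of $S$. -}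

module Defs where

open import Data.Bool using (if_then_else_)
open import Data.List using (List; []; _∷_; [_]; _++_; length; reverse; map; sum; filter; take)
open import Data.List.Properties using (≡-dec)
open import Data.List.Membership.DecPropositional using ()
open import Data.List.Relation.Binary.Infix.Heterogeneous using (Infix)
open import Data.List.Relation.Binary.Prefix.Heterogeneous.Properties using (prefix?)
open import Data.Nat using (ℕ; _∸_; _≤_; _<_)
open import Data.Product using (_×_; ∃-syntax)
open import Data.Sum using (_⊎_)
open import Relation.Binary.Construct.Closure.ReflexiveTransitive using (Star)
open import Relation.Binary.Definitions using (DecidableEquality)
open import Relation.Binary.PropositionalEquality using (_≡_; _≢_)
open import Relation.Nullary using (¬_; ¬?; does)

-- A finite set of strings is represented by a duplicate-free list; `insert`
-- and the `filter`s below preserve duplicate-freeness, so `length` is the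
-- cardinality.

module Strings {A : Set} (_≟_ : DecidableEquality A) where

  String : Set
  String = List A

  _≟ˢ_ : DecidableEquality String
  _≟ˢ_ = ≡-dec _≟_

  open Data.List.Membership.DecPropositional _≟ˢ_ using (_∈_; _∉_; _∈?_; _∉?_)

  Factor : String → String → Set
  Factor = Infix _≡_

  ov : String → String → ℕ
  ov []           y = 0
  ov x@(_ ∷ x′) y = if does (prefix? _≟_ x y) then length x else ov x′ y

  pref : String → String → String
  pref x y = take (length x ∸ ov x y) x

  infixr 6 _⊗_
  _⊗_ : String → String → String
  x ⊗ y = pref x y ++ y

  totalLength : List String → ℕ
  totalLength S = sum (map length S)

  insert : String → List String → List String
  insert x S = if does (x ∈? S) then S else x ∷ S

  -- Possibly with repetitions: used only through membership.
  tilde : List String → List String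
  tilde X = X ++ map reverse X

  FactorUpToReversal : String → String → Set
  FactorUpToReversal x y = Factor x y ⊎ Factor x (reverse y)

  ReverseFactorFree : List String → Set
  ReverseFactorFree X = ∀ {x y} → x ∈ X → y ∈ X → x ≢ y → ¬ FactorUpToReversal x y

  data _⟶ʳ_ (X : List String) : List String → Set where
    remove : ∀ {x y} → x ∈ X → y ∈ X → y ≢ x → FactorUpToReversal x y →
             X ⟶ʳ filter (λ z → ¬? (z ≟ˢ x)) X

  MakeReverseFactorFree : List String → List String → Set
  MakeReverseFactorFree X Y = Star _⟶ʳ_ X Y × ReverseFactorFree Y

  Candidate : List String → String → String → Set
  Candidate S u v = u ∈ tilde S × v ∈ tilde S × u ∉ (v ∷ reverse v ∷ [])

  MaximalCandidate : List String → String → String → Set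
  MaximalCandidate S u v =
    Candidate S u v × (∀ {u′ v′} → Candidate S u′ v′ → ov u′ v′ ≤ ov u v)

  merge : List String → String → String → List String
  merge S u v =
    filter (_∉? (u ∷ v ∷ reverse u ∷ reverse v ∷ [])) (insert (u ⊗ v) S)

  data _⟶ᵍ_ (S : List String) : List String → Set where
    greedy : ∀ {u v} → 1 < length S → MaximalCandidate S u v → S ⟶ᵍ merge S u v

  -- GreedyR S w : some run of the (nondeterministic) algorithm on S returns w.
  GreedyR : List String → String → Set
  GreedyR S w = ∃[ T ] (MakeReverseFactorFree S T × Star _⟶ᵍ_ T [ w ])

  CommonSuperstringWithReversals : List String → String → Set
  CommonSuperstringWithReversals S t =
    ∀ {s} → s ∈ S → Factor s t ⊎ Factor (reverse s) t

  IsShortestLength : List String → ℕ → Set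
  IsShortestLength S k =
    (∃[ t ] (CommonSuperstringWithReversals S t × length t ≡ k))
    × (∀ t → CommonSuperstringWithReversals S t → k ≤ length t)

{-# OPTIONS --safe #-}
-- Let t contain every string of S up to reversal, and let a greedy step merge
-- u = p z and v = z q, where z is their overlap.  The step shortens the total
-- length of S by |z|, while t can be cut and reassembled into a superstring of
-- the new set of length |t| + |z|.  Hence |t| + totalLength S does not increase
-- along a run; it ends at or above 2 |w|, and starts at k-min + n.
--
-- For the reassembly, maximality of |z| says that distinct strings of S, each
-- reversed or not, overlap by at most |z|.  Up to reversing t and exchanging (u, v) for (vᴿ, uᴿ), there are
-- three relative positions of u and v in t:
--   t = a p k z q d    (u before v)    becomes  a p z q d · k z
--   t = a p k qᴿ zᴿ d  (u before vᴿ)   becomes  a p z q kᴿ zᴿ d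
--   t = c r k p z b    (v before u)    becomes  c z b · k p z q,
-- where r is the prefix of v of length |q|.  By the bound on overlaps, an
-- occurrence in t of any other string of S lies within a part of t that is
-- kept in one piece (or reversed in one piece).
module Submission where

open import Defs
open import Data.Empty using (⊥)
open import Data.Integer using (+_)
import Data.Integer as ℤ
import Data.Integer.Properties as ℤ
import Data.Integer.Tactic.RingSolver as ℤ-solver
open import Data.List using (List; []; _∷_; [_]; _++_; length; reverse; map; filter; take; drop; concat)
open import Data.List.Membership.DecPropositional as DecMembership using ()
open import Data.List.Membership.Propositional.Properties
  using (∈-++⁻; ∈-++⁺ˡ; ∈-++⁺ʳ; ∈-map⁻; ∈-map⁺; ∈-filter⁻)
open import Data.List.Properties
open import Data.List.Relation.Binary.Infix.Heterogeneous using (Infix; _++ⁱ_; _ⁱ++_; toView; MkView)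
open import Data.List.Relation.Binary.Infix.Heterogeneous.Properties as Infix using (fromPointwise)
open import Data.List.Relation.Binary.Pointwise as Pointwise using (Pointwise-≡⇒≡)
import Data.List.Relation.Binary.Prefix.Heterogeneous as Prefix
open import Data.List.Relation.Binary.Prefix.Heterogeneous.Properties using (prefix?)
open import Data.List.Relation.Unary.Any using (here; there)
open import Data.List.Relation.Unary.Unique.Propositional using (Unique)
open import Data.Nat using (ℕ; z≤n; s≤s; _+_; _∸_; _≤_; _<_)
open import Data.Nat.ListAction using (sum)
open import Data.Nat.Properties
open import Data.Nat.Tactic.RingSolver using (solve-∀)
open import Data.Product using (_×_; ∃-syntax; _,_)
import Data.Rational as ℚ
open import Data.Rational using (½; _*_; _-_; _≥_; toℚᵘ)
open import Data.Rational.Literals using (fromℤ)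
open import Data.Rational.Properties using (toℚᵘ-cancel-≤; toℚᵘ-homo-+; toℚᵘ-homo-*; toℚᵘ-homo‿-)
import Data.Rational.Unnormalised as ℚᵘ
import Data.Rational.Unnormalised.Properties as ℚᵘ
open import Data.Sum using (_⊎_; inj₁; inj₂)
open import Relation.Binary.Construct.Closure.ReflexiveTransitive using (Star; ε; _◅_)
open import Relation.Binary.Definitions using (DecidableEquality)
open import Relation.Binary.PropositionalEquality hiding ([_])
open import Relation.Nullary using (yes; no; Dec; ¬_; contradiction)
open import Tactic.MonoidSolver using (solve)

-- Factors, reversal and relative positions of occurrences.

module _ {A : Set} where

  -- Reverses the factor, as `CommonSuperstringWithReversals` does, whereas `FactorUpToReversal`
  -- reverses the host word; the two are translated into each other further on.
  Contains : List A → List A → Set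
  Contains x t = Infix _≡_ x t ⊎ Infix _≡_ (reverse x) t

  infix⁺ : ∀ (l {s} r : List A) {t} → t ≡ l ++ s ++ r → Infix _≡_ s t
  infix⁺ l r refl = l ++ⁱ (fromPointwise (Pointwise.refl refl) ⁱ++ r)

  infix⁻ : ∀ {s t : List A} → Infix _≡_ s t → ∃[ l ] ∃[ r ] t ≡ l ++ s ++ r
  infix⁻ i with toView i
  ... | MkView l s≋ r with refl ← Pointwise-≡⇒≡ s≋ = l , r , refl

  reverse-++₃ : ∀ (x y z : List A) →
                reverse (x ++ y ++ z) ≡ reverse z ++ reverse y ++ reverse x
  reverse-++₃ x y z = begin
    reverse (x ++ y ++ z)                  ≡⟨ reverse-++ x (y ++ z) ⟩
    reverse (y ++ z) ++ reverse x          ≡⟨ cong (_++ reverse x) (reverse-++ y z) ⟩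
    (reverse z ++ reverse y) ++ reverse x  ≡⟨ ++-assoc (reverse z) _ _ ⟩
    reverse z ++ reverse y ++ reverse x ∎
    where open ≡-Reasoning

  infix-reverse : ∀ {s t : List A} → Infix _≡_ s t → Infix _≡_ (reverse s) (reverse t)
  infix-reverse i with l , r , refl ← infix⁻ i = infix⁺ (reverse r) (reverse l) (reverse-++₃ l _ r)

  length-concat : ∀ (xss : List (List A)) → length (concat xss) ≡ sum (map length xss)
  length-concat []         = refl
  length-concat (xs ∷ xss) = trans (length-++ xs) (cong (λ n → length xs + n) (length-concat xss))

  -- Reduces the length of a word reassembled from blocks to an equation between sums of block
  -- lengths, which the ring solver settles. Words written as `... ++ []` below are in this form
  -- because `concat` unfolds to it.
  length-concat-≡ : ∀ (yss xss : List (List A)) {t o} → t ≡ concat xss →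
    sum (map length yss) ≡ sum (map length xss) + o → length (concat yss) ≡ length t + o
  length-concat-≡ yss xss {o = o} refl eq = begin
    length (concat yss)         ≡⟨ length-concat yss ⟩
    sum (map length yss)        ≡⟨ eq ⟩
    sum (map length xss) + o    ≡⟨ cong (_+ o) (length-concat xss) ⟨
    length (concat xss) + o ∎
    where open ≡-Reasoning

  infix-within : ∀ l x r {s t : List A} → Infix _≡_ s x → t ≡ l ++ x ++ r → Infix _≡_ s t
  infix-within l x r i refl = l ++ⁱ (i ⁱ++ r)

  ++-cancel-both : ∀ (l {x y} r : List A) → l ++ x ++ r ≡ l ++ y ++ r → x ≡ y
  ++-cancel-both l r eq = ++-cancelʳ r _ _ (++-cancelˡ l _ _ eq)

  -- Levi's lemma: two cuts of one word have a common refinement, with `e` the piece between the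
  -- cuts.
  levi : ∀ (a {b} c {d} : List A) → a ++ b ≡ c ++ d →
         (∃[ e ] c ≡ a ++ e × b ≡ e ++ d) ⊎ (∃[ e ] a ≡ c ++ e × d ≡ e ++ b)
  levi []      c       eq = inj₁ (c , refl , eq)
  levi (x ∷ a) []      eq = inj₂ (x ∷ a , refl , sym eq)
  levi (x ∷ a) (y ∷ c) eq with refl , eq′ ← ∷-injective eq with levi a c eq′
  ... | inj₁ (e , p , q) = inj₁ (e , cong (x ∷_) p , q)
  ... | inj₂ (e , p , q) = inj₂ (e , cong (x ∷_) p , q)

  -- In a word a s b = c s′ d, the displayed occurrence of s both starts and
  -- ends no later than that of s′.
  record Before (a s b c s′ d : List A) : Set where
    constructor before
    field
      {e f}  : List A
      starts : c ≡ a ++ e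
      ends   : b ≡ f ++ d
      middle : s ++ f ≡ e ++ s′

  -- `levi` compares the left ends, then the right ends. An occurrence that starts first and ends
  -- last would contain the other, so both comparisons agree.
  occurrences-ordered : ∀ (a {s} b c {s′} d : List A) → a ++ s ++ b ≡ c ++ s′ ++ d →
    ¬ Infix _≡_ s s′ → ¬ Infix _≡_ s′ s → Before a s b c s′ d ⊎ Before c s′ d a s b
  occurrences-ordered a {s} b c {s′} d eq s⋢s′ s′⋢s with levi a c eq
  ... | inj₁ (e , c≡ , sb≡) with levi s (e ++ s′) (trans sb≡ (sym (++-assoc e s′ d)))
  ...   | inj₁ (f , es′≡ , b≡) = inj₁ (before c≡ b≡ (sym es′≡))
  ...   | inj₂ (f , s≡ , _)    = contradiction (infix⁺ e f (trans s≡ (++-assoc e s′ f))) s′⋢s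
  occurrences-ordered a {s} b c {s′} d eq s⋢s′ s′⋢s
      | inj₂ (e , a≡ , s′d≡) with levi s′ (e ++ s) (trans s′d≡ (sym (++-assoc e s b)))
  ...   | inj₁ (f , es≡ , d≡) = inj₂ (before a≡ d≡ (sym es≡))
  ...   | inj₂ (f , s′≡ , _)  = contradiction (infix⁺ e f (trans s′≡ (++-assoc e s f))) s⋢s′

  -- With `before-suffix`, this locates an occurrence using only the order of its right (left) end
  -- relative to another one, without any bound on overlaps.
  before-prefix : ∀ {a s b c s′ d} → Before a s b c s′ d → Infix _≡_ s (c ++ s′)
  before-prefix {a} {s} {c = c} {s′} (before {e} {f} refl _ mid) =
    infix⁺ a f (trans (++-assoc a e s′) (cong (a ++_) (sym mid)))

  before-suffix : ∀ {a s b c s′ d} → Before a s b c s′ d → Infix _≡_ s′ (s ++ b)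
  before-suffix {s = s} {s′ = s′} {d = d} (before {e} {f} _ refl mid) =
    infix⁺ e d (begin
      s ++ f ++ d     ≡⟨ ++-assoc s f d ⟨
      (s ++ f) ++ d   ≡⟨ cong (_++ d) mid ⟩
      (e ++ s′) ++ d  ≡⟨ ++-assoc e s′ d ⟩
      e ++ s′ ++ d ∎)
    where open ≡-Reasoning

  -- Bounded overlaps and the positions they force.

  -- Phrased by factorisations instead of `ov`: no decidable equality is involved, and the bound
  -- applies directly to the pieces that `levi` yields.
  OverlapsBoundedBy : ℕ → List A → List A → Set
  OverlapsBoundedBy o s s′ = ∀ p z q → s ≡ p ++ z → s′ ≡ z ++ q → length z ≤ o

  ++-longer-suffix : ∀ (p z p′ z′ : List A) → p ++ z ≡ p′ ++ z′ → length z′ ≤ length z →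
                     ∃[ h ] p′ ≡ p ++ h
  ++-longer-suffix p z p′ z′ eq ≤z with levi p p′ eq
  ... | inj₁ (h , p′≡ , _)        = h , p′≡
  ... | inj₂ ([] , p≡ , _)       = [] , sym (trans (++-identityʳ p) (trans p≡ (++-identityʳ p′)))
  ... | inj₂ (x ∷ h , p≡ , refl) = contradiction ≤z (<⇒≱ (≤-<-trans (length-++-≤ʳ z {h}) (n<1+n _)))

  ++-longer-prefix : ∀ (z q z′ q′ : List A) → z ++ q ≡ z′ ++ q′ → length z′ ≤ length z →
                     ∃[ h ] q′ ≡ h ++ q
  ++-longer-prefix z q z′ q′ eq ≤z with levi z z′ eq
  ... | inj₂ (h , _ , q′≡)          = h , q′≡
  ... | inj₁ ([] , _ , q≡)          = [] , sym q≡
  ... | inj₁ (x ∷ h , refl , _) = contradiction ≤z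
    (<⇒≱ (subst (length z <_) (sym (length-++ z)) (m<m+n _ (s≤s z≤n))))

  -- Either `s′` starts after `s` has ended, or the two share a suffix of `s` of length at most `o`,
  -- hence at most `|z|`. In both cases `p` lies entirely in front of `s′`.
  before-start : ∀ {a s b c s′ d o} (p z : List A) → s ≡ p ++ z → Before a s b c s′ d →
    OverlapsBoundedBy o s s′ → o ≤ length z → ∃[ h ] c ≡ a ++ p ++ h
  before-start {a} p z refl (before {e} {f} c≡ _ mid) bd o≤ with levi (p ++ z) e mid
  ... | inj₁ (h , e≡ , _) = z ++ h , trans c≡ (cong (a ++_) (trans e≡ (++-assoc p z h)))
  ... | inj₂ (g , pz≡ , s′≡)
      with h , e≡ ← ++-longer-suffix p z e g pz≡ (≤-trans (bd e g f pz≡ s′≡) o≤)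
      = h , trans c≡ (cong (a ++_) e≡)

  -- The mirror image of `before-start`: `s` may reach into the prefix `z` of the later occurrence,
  -- but never into `q`.
  before-end : ∀ {a s b c d o} (z q : List A) → Before a s b c (z ++ q) d →
    OverlapsBoundedBy o s (z ++ q) → o ≤ length z → ∃[ h ] b ≡ h ++ q ++ d
  before-end {d = d} z q (before {e} {f} _ b≡ mid) bd o≤ with levi _ e mid
  ... | inj₁ (h , _ , f≡) = h ++ z , trans b≡ (trans (cong (_++ d) f≡) (solve (++-monoid A)))
  ... | inj₂ (g , s≡ , zq≡)
      with h , f≡ ← ++-longer-prefix z q g f zq≡ (≤-trans (bd e g f s≡ zq≡) o≤)
      = h , trans b≡ (trans (cong (_++ d) f≡) (++-assoc h q d))

  -- Everything used about two strings that are not equal up to reversal. Both directions are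
  -- recorded because either one may occur first in the superstring.
  record Apart (o : ℕ) (x y : List A) : Set where
    field
      ⋢ : ¬ Infix _≡_ x y
      ⋣ : ¬ Infix _≡_ y x
      ov≤ : OverlapsBoundedBy o x y
      ≥vo : OverlapsBoundedBy o y x

  apart-sym : ∀ {o x y} → Apart o x y → Apart o y x
  apart-sym a = record { ⋢ = ⋣ ; ⋣ = ⋢ ; ov≤ = ≥vo ; ≥vo = ov≤ }
    where open Apart a

  apart-ordered : ∀ {o} a {s} b c {s′} d → Apart o s s′ → a ++ s ++ b ≡ c ++ s′ ++ d →
                  Before a s b c s′ d ⊎ Before c s′ d a s b
  apart-ordered a b c d ap eq = occurrences-ordered a b c d eq ⋢ ⋣
    where open Apart ap

  -- Reassembling a superstring, by the relative position of `u` and `v`.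

  -- Here v may also be the reversal of the string that u is merged with.
  record Rearrangement (o : ℕ) (t m u v : List A) : Set where
    field
      result     : List A
      result-len : length result ≡ length t + o
      merged     : Contains m result
      kept       : ∀ {s} → Apart o s u → Apart o s v → Infix _≡_ s t → Contains s result

  -- An occurrence of another string before `u` lies in `a p z`, and one after `v` lies in `z q d`.
  -- One that comes after `u` and before `v` starts past `p` and ends before `q`, so it lies in
  -- `k z`; this is why `k z` is appended.
  same-order : ∀ {o t} (p z q : List A) → o ≡ length z → Apart o (p ++ z) (z ++ q) →
    ∀ {a b c d} → t ≡ a ++ (p ++ z) ++ b → t ≡ c ++ (z ++ q) ++ d →
    Before a (p ++ z) b c (z ++ q) d → Rearrangement o t (p ++ z ++ q) (p ++ z) (z ++ q)
  same-order {t = t} p z q refl ap {a} {b} {c} {d} t≡u t≡v uv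
    with k , refl ← before-start p z refl uv (Apart.ov≤ ap) ≤-refl = record
    { result     = t′
    ; result-len = length-concat-≡ (a ∷ p ∷ z ∷ q ∷ d ∷ k ∷ z ∷ []) (a ∷ p ∷ k ∷ z ∷ q ∷ d ∷ [])
        (trans t≡v t≡)
        (len (length a) (length p) (length k) (length z) (length q) (length d))
    ; merged     = inj₁ (infix⁺ a (d ++ k ++ z) (solve (++-monoid A)))
    ; kept       = λ apu apv i → inj₁ (keep apu apv (infix⁻ i))
    }
    where
    open ≡-Reasoning
    t′ : List A
    t′ = a ++ p ++ z ++ q ++ d ++ k ++ z ++ []
    t≡ : (a ++ p ++ k) ++ (z ++ q) ++ d ≡ a ++ p ++ k ++ z ++ q ++ d ++ []
    t≡ = solve (++-monoid A)
    len : ∀ a p k z q d → a + (p + (z + (q + (d + (k + (z + 0)))))) ≡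
                          a + (p + (k + (z + (q + (d + 0))))) + z
    len = solve-∀
    keep : ∀ {s} → Apart (length z) s (p ++ z) → Apart (length z) s (z ++ q) →
           ∃[ x ] ∃[ y ] t ≡ x ++ s ++ y → Infix _≡_ s t′
    keep {s} apu apv (x , y , t≡s)
      with apart-ordered x y a b apu (trans (sym t≡s) t≡u)
    ... | inj₁ su = infix-within [] (a ++ p ++ z) (q ++ d ++ k ++ z) (before-prefix su) (solve (++-monoid A))
    ... | inj₂ us with apart-ordered x y (a ++ p ++ k) d apv (trans (sym t≡s) t≡v)
    ...   | inj₂ vs =
      infix-within (a ++ p) ((z ++ q) ++ d) (k ++ z) (before-suffix vs) (solve (++-monoid A))
    ...   | inj₁ sv
      with m , refl ← before-start p z refl us (Apart.≥vo apu) ≤-refl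
         | h , refl ← before-end z q sv (Apart.ov≤ apv) ≤-refl =
      infix-within (a ++ p ++ z ++ q ++ d) (k ++ z) [] (infix⁺ m h kz≡) (solve (++-monoid A))
      where
      kz≡ : k ++ z ≡ m ++ s ++ h
      kz≡ = ++-cancel-both (a ++ p) (q ++ d) (begin
        (a ++ p) ++ (k ++ z) ++ q ++ d        ≡⟨ solve (++-monoid A) ⟩
        (a ++ p ++ k) ++ (z ++ q) ++ d        ≡⟨ t≡v ⟨
        t                                     ≡⟨ t≡s ⟩
        (a ++ p ++ m) ++ s ++ h ++ q ++ d     ≡⟨ solve (++-monoid A) ⟩
        (a ++ p) ++ (m ++ s ++ h) ++ q ++ d ∎)

  split-length : ∀ m (xs : List A) {n} → length xs ≡ m + n →
                 ∃[ ys ] ∃[ zs ] xs ≡ ys ++ zs × length ys ≡ m × length zs ≡ n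
  split-length m xs {n} eq = take m xs , drop m xs , sym (take++drop≡id m xs)
    , trans (length-take m xs) (m≤n⇒m⊓n≡m (subst (m ≤_) (sym eq) (m≤m+n m n)))
    , trans (length-drop m xs) (trans (cong (_∸ m) eq) (m+n∸m≡n m n))

  -- An occurrence before `v` ends before `q`, so it lies in `c z`; one after `u` starts past `p`,
  -- so it lies in `z b`; one in between starts past `p₂` and ends no later than `u`, so it lies in
  -- `k p z`.
  swapped-order : ∀ {o t} (p z q : List A) → o ≡ length z → Apart o (z ++ q) (p ++ z) →
    ∀ {a b c d} → t ≡ a ++ (p ++ z) ++ b → t ≡ c ++ (z ++ q) ++ d →
    Before c (z ++ q) d a (p ++ z) b → Rearrangement o t (p ++ z ++ q) (p ++ z) (z ++ q)
  swapped-order {t = t} p z q refl ap {a} {b} {c} {d} t≡u t≡v vu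
    -- `v` is cut a second time, now after `|q|` letters. The rest `z₂` has length `|z|`, so
    -- `before-start` places `p₂` wholly in front of `u`. In the length count the dropped `p₂` and
    -- the appended `q` cancel, leaving one extra `z`.
    with p₂ , z₂ , v≡p₂z₂ , |p₂| , |z₂| ← split-length (length q) (z ++ q)
         (trans (length-++ z) (+-comm (length z) _))
    with k , refl ← before-start p₂ z₂ v≡p₂z₂ vu (Apart.ov≤ ap) (≤-reflexive (sym |z₂|)) = record
    { result     = t′
    ; result-len = length-concat-≡ (c ∷ z ∷ b ∷ k ∷ p ∷ z ∷ q ∷ []) (c ∷ p₂ ∷ k ∷ p ∷ z ∷ b ∷ [])
        (trans t≡u t≡)
        (trans (len (length c) (length z) (length b) (length k) (length p) (length q))
          (cong (λ l → length c + (l + _) + _) (sym |p₂|)))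
    ; merged     = inj₁ (infix⁺ (c ++ z ++ b ++ k) [] (solve (++-monoid A)))
    ; kept       = λ apu apv i → inj₁ (keep apu apv (infix⁻ i))
    }
    where
    open ≡-Reasoning
    t′ : List A
    t′ = c ++ z ++ b ++ k ++ p ++ z ++ q ++ []
    t≡ : (c ++ p₂ ++ k) ++ (p ++ z) ++ b ≡ c ++ p₂ ++ k ++ p ++ z ++ b ++ []
    t≡ = solve (++-monoid A)
    len : ∀ c z b k p q → c + (z + (b + (k + (p + (z + (q + 0)))))) ≡
                          c + (q + (k + (p + (z + (b + 0))))) + z
    len = solve-∀
    keep : ∀ {s} → Apart (length z) s (p ++ z) → Apart (length z) s (z ++ q) →
           ∃[ x ] ∃[ y ] t ≡ x ++ s ++ y → Infix _≡_ s t′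
    keep {s} apu apv (x , y , t≡s)
      with apart-ordered x y c d apv (trans (sym t≡s) t≡v)
    ... | inj₁ sv
      with h , refl ← before-end z q sv (Apart.ov≤ apv) ≤-refl =
      infix-within [] (c ++ z) (b ++ k ++ p ++ z ++ q) (infix⁺ x h cz≡) (solve (++-monoid A))
      where
      cz≡ : c ++ z ≡ x ++ s ++ h
      cz≡ = ++-cancelʳ (q ++ d) _ _ (begin
        (c ++ z) ++ q ++ d        ≡⟨ solve (++-monoid A) ⟩
        c ++ (z ++ q) ++ d        ≡⟨ t≡v ⟨
        t                         ≡⟨ t≡s ⟩
        x ++ s ++ h ++ q ++ d     ≡⟨ solve (++-monoid A) ⟩
        (x ++ s ++ h) ++ q ++ d ∎)
    ... | inj₂ vs
      with apart-ordered x y (c ++ p₂ ++ k) b apu (trans (sym t≡s) t≡u)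
    ...   | inj₂ us
      with m , refl ← before-start p z refl us (Apart.≥vo apu) ≤-refl =
      infix-within c (z ++ b) (k ++ p ++ z ++ q) (infix⁺ m y zb≡) (solve (++-monoid A))
      where
      zb≡ : z ++ b ≡ m ++ s ++ y
      zb≡ = ++-cancelˡ ((c ++ p₂ ++ k) ++ p) _ _ (begin
        ((c ++ p₂ ++ k) ++ p) ++ z ++ b        ≡⟨ solve (++-monoid A) ⟩
        (c ++ p₂ ++ k) ++ (p ++ z) ++ b        ≡⟨ t≡u ⟨
        t                                      ≡⟨ t≡s ⟩
        ((c ++ p₂ ++ k) ++ p ++ m) ++ s ++ y   ≡⟨ solve (++-monoid A) ⟩
        ((c ++ p₂ ++ k) ++ p) ++ m ++ s ++ y ∎)
    ...   | inj₁ (before {e} {f} _ refl _)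
      with m , refl ← before-start p₂ z₂ v≡p₂z₂ vs (Apart.≥vo apv) (≤-reflexive (sym |z₂|)) =
      infix-within (c ++ z ++ b) (k ++ p ++ z) q (infix⁺ m f kpz≡) (solve (++-monoid A))
      where
      kpz≡ : k ++ p ++ z ≡ m ++ s ++ f
      kpz≡ = ++-cancel-both (c ++ p₂) b (begin
        (c ++ p₂) ++ (k ++ p ++ z) ++ b        ≡⟨ solve (++-monoid A) ⟩
        (c ++ p₂ ++ k) ++ (p ++ z) ++ b        ≡⟨ t≡u ⟨
        t                                      ≡⟨ t≡s ⟩
        (c ++ p₂ ++ m) ++ s ++ f ++ b          ≡⟨ solve (++-monoid A) ⟩
        (c ++ p₂) ++ (m ++ s ++ f) ++ b ∎)

  -- The block `k qᴿ zᴿ` is replaced by its reversal `z q kᴿ`, which creates `p z q`, and a copy of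
  -- `zᴿ` is put back in front of `d`. An occurrence before `u` lies in `a p z`, one after `v′` in
  -- `zᴿ d`, and one in between lies in the reversed block, so its reversal occurs in the result.
  -- `v′` is given by an equation so that `u` itself can take this role later.
  reversed-order : ∀ {o t v′} (p z q : List A) → o ≡ length z →
    v′ ≡ reverse q ++ reverse z → Apart o (p ++ z) v′ →
    ∀ {a b c d} → t ≡ a ++ (p ++ z) ++ b → t ≡ c ++ v′ ++ d → Before a (p ++ z) b c v′ d →
    Rearrangement o t (p ++ z ++ q) (p ++ z) v′
  reversed-order {t = t} p z q refl refl ap {a} {b} {c} {d} t≡u t≡v uv
    with k , refl ← before-start p z refl uv (Apart.ov≤ ap) ≤-refl = record
    { result     = t′
    ; result-len = length-concat-≡ (a ∷ p ∷ z ∷ q ∷ reverse k ∷ reverse z ∷ d ∷ [])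
                                   (a ∷ p ∷ k ∷ reverse q ∷ reverse z ∷ d ∷ [])
        (trans t≡v t≡) len
    ; merged     = inj₁ (infix⁺ a (reverse k ++ reverse z ++ d) (solve (++-monoid A)))
    ; kept       = λ apu apv i → keep apu apv (infix⁻ i)
    }
    where
    open ≡-Reasoning
    z′ q′ k′ t′ : List A
    z′ = reverse z
    q′ = reverse q
    k′ = reverse k
    t′ = a ++ p ++ z ++ q ++ k′ ++ z′ ++ d ++ []
    t≡ : (a ++ p ++ k) ++ (q′ ++ z′) ++ d ≡ a ++ p ++ k ++ q′ ++ z′ ++ d ++ []
    t≡ = solve (++-monoid A)
    len : sum (map length (a ∷ p ∷ z ∷ q ∷ k′ ∷ z′ ∷ d ∷ [])) ≡
          sum (map length (a ∷ p ∷ k ∷ q′ ∷ z′ ∷ d ∷ [])) + length z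
    len rewrite length-reverse k | length-reverse q | length-reverse z =
      arithmetic (length a) (length p) (length k) (length z) (length q) (length d)
      where
      arithmetic : ∀ a p k z q d → a + (p + (z + (q + (k + (z + (d + 0)))))) ≡
                                   a + (p + (k + (q + (z + (d + 0))))) + z
      arithmetic = solve-∀
    keep : ∀ {s} → Apart (length z) s (p ++ z) → Apart (length z) s (q′ ++ z′) →
           ∃[ x ] ∃[ y ] t ≡ x ++ s ++ y → Contains s t′
    keep {s} apu apv (x , y , t≡s)
      with apart-ordered x y a b apu (trans (sym t≡s) t≡u)
    ... | inj₁ su = inj₁ (infix-within [] (a ++ p ++ z) (q ++ k′ ++ z′ ++ d) (before-prefix su) (solve (++-monoid A)))
    ... | inj₂ us with apart-ordered x y (a ++ p ++ k) d apv (trans (sym t≡s) t≡v)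
    ...   | inj₂ vs
      with m , refl ← before-start q′ z′ refl vs (Apart.≥vo apv) (≤-reflexive (sym (length-reverse z))) =
      inj₁ (infix-within (a ++ p ++ z ++ q ++ k′) (z′ ++ d) [] (infix⁺ m y z′d≡) (solve (++-monoid A)))
      where
      z′d≡ : z′ ++ d ≡ m ++ s ++ y
      z′d≡ = ++-cancelˡ (a ++ p ++ k ++ q′) _ _ (begin
        (a ++ p ++ k ++ q′) ++ z′ ++ d            ≡⟨ solve (++-monoid A) ⟩
        (a ++ p ++ k) ++ (q′ ++ z′) ++ d          ≡⟨ t≡v ⟨
        t                                         ≡⟨ t≡s ⟩
        ((a ++ p ++ k) ++ q′ ++ m) ++ s ++ y      ≡⟨ solve (++-monoid A) ⟩
        (a ++ p ++ k ++ q′) ++ m ++ s ++ y ∎)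
    ...   | inj₁ (before {e} {f} _ refl _)
      with m , refl ← before-start p z refl us (Apart.≥vo apu) ≤-refl =
      inj₂ (infix-within (a ++ p) (z ++ q ++ k′) (z′ ++ d)
             (subst (Infix _≡_ (reverse s)) rev≡ (infix-reverse (infix⁺ m f kqz≡))) (solve (++-monoid A)))
      where
      kqz≡ : k ++ q′ ++ z′ ≡ m ++ s ++ f
      kqz≡ = ++-cancel-both (a ++ p) d (begin
        (a ++ p) ++ (k ++ q′ ++ z′) ++ d      ≡⟨ solve (++-monoid A) ⟩
        (a ++ p ++ k) ++ (q′ ++ z′) ++ d      ≡⟨ t≡v ⟨
        t                                     ≡⟨ t≡s ⟩
        (a ++ p ++ m) ++ s ++ f ++ d          ≡⟨ solve (++-monoid A) ⟩
        (a ++ p) ++ (m ++ s ++ f) ++ d ∎)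
      rev≡ : reverse (k ++ q′ ++ z′) ≡ z ++ q ++ k′
      rev≡ = trans (reverse-++₃ k q′ z′)
        (cong₂ (λ x y → x ++ y ++ k′) (reverse-involutive z) (reverse-involutive q))

  -- Words up to reversal, and reduction to the three positions.

  infix 4 _∼_
  _∼_ : List A → List A → Set
  x ∼ y = x ≡ y ⊎ x ≡ reverse y

  ∼-refl : ∀ {x} → x ∼ x
  ∼-refl = inj₁ refl

  ∼-sym : ∀ {x y} → x ∼ y → y ∼ x
  ∼-sym (inj₁ refl) = inj₁ refl
  ∼-sym (inj₂ refl) = inj₂ (sym (reverse-involutive _))

  ∼-trans : ∀ {x y z} → x ∼ y → y ∼ z → x ∼ z
  ∼-trans (inj₁ refl) y∼z         = y∼z
  ∼-trans (inj₂ refl) (inj₁ refl) = inj₂ refl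
  ∼-trans (inj₂ refl) (inj₂ refl) = inj₁ (reverse-involutive _)

  reverse-∼ : ∀ x → reverse x ∼ x
  reverse-∼ _ = inj₂ refl

  length-∼ : ∀ {x y} → x ∼ y → length x ≡ length y
  length-∼ (inj₁ refl) = refl
  length-∼ {y = y} (inj₂ refl) = length-reverse y

  contains-∼ : ∀ {x y t} → x ∼ y → Contains x t → Contains y t
  contains-∼ (inj₁ refl) c        = c
  contains-∼ {y = y} {t} (inj₂ refl) (inj₁ i) = inj₂ i
  contains-∼ {y = y} {t} (inj₂ refl) (inj₂ i) = inj₁ (subst (λ x → Infix _≡_ x t) (reverse-involutive y) i)

  contains-reverse : ∀ {x t} → Contains x t → Contains x (reverse t)
  contains-reverse (inj₁ i)         = inj₂ (infix-reverse i)
  contains-reverse {x} {t} (inj₂ i) =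
    inj₁ (subst (λ y → Infix _≡_ y (reverse t)) (reverse-involutive x) (infix-reverse i))

  contains-in-∼ : ∀ {x t t′} → t ∼ t′ → Contains x t → Contains x t′
  contains-in-∼ (inj₁ refl) c = c
  contains-in-∼ {x} {t′ = t′} (inj₂ refl) c =
    subst (Contains x) (reverse-involutive t′) (contains-reverse c)

  -- The hypothesis of `kept` covers all reversals and is symmetric in `u` and `v`. Hence a
  -- `Rearrangement` of reversed or exchanged strings also yields this record.
  record SuperstringMerging (o : ℕ) (t m u v : List A) : Set where
    field
      result     : List A
      result-len : length result ≡ length t + o
      merged     : Contains m result
      kept       : ∀ {s} → (∀ {x y} → x ∼ s → y ∼ u ⊎ y ∼ v → Apart o x y) →
                   Contains s t → Contains s result

  up-to-reversal : ∀ {o t m m′ u u′ v v′} → Rearrangement o t m′ u′ v′ →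
    m′ ∼ m → u′ ∼ u ⊎ u′ ∼ v → v′ ∼ u ⊎ v′ ∼ v → SuperstringMerging o t m u v
  up-to-reversal r m∼ u∼ v∼ = record
    { result     = result
    ; result-len = result-len
    ; merged     = contains-∼ m∼ merged
    ; kept       = λ where
        ap (inj₁ i) → kept (ap ∼-refl u∼) (ap ∼-refl v∼) i
        ap (inj₂ i) → contains-∼ (reverse-∼ _) (kept (ap (reverse-∼ _) u∼) (ap (reverse-∼ _) v∼) i)
    }
    where open Rearrangement r

  merge-in-superstring : ∀ {o t} (p z q : List A) → o ≡ length z →
    (∀ {x y} → x ∼ p ++ z → y ∼ z ++ q → Apart o x y) →
    Contains (p ++ z) t → Contains (z ++ q) t →
    SuperstringMerging o t (p ++ z ++ q) (p ++ z) (z ++ q)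
  merge-in-superstring {o} p z q o≡ ap = by-orientation
    where
    v′∼v : reverse q ++ reverse z ∼ z ++ q
    v′∼v = inj₂ (sym (reverse-++ z q))
    m′∼m : reverse q ++ reverse z ++ reverse p ∼ p ++ z ++ q
    m′∼m = inj₂ (sym (reverse-++₃ p z q))
    u≡ : p ++ z ≡ reverse (reverse p) ++ reverse (reverse z)
    u≡ = sym (cong₂ _++_ (reverse-involutive p) (reverse-involutive z))

    from-infix : ∀ {t} → Infix _≡_ (p ++ z) t → Contains (z ++ q) t →
                 SuperstringMerging o t (p ++ z ++ q) (p ++ z) (z ++ q)
    from-infix u∈t (inj₁ v∈t) with a , b , t≡u ← infix⁻ u∈t | c , d , t≡v ← infix⁻ v∈t
      with apart-ordered a b c d (ap ∼-refl ∼-refl) (trans (sym t≡u) t≡v)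
    ... | inj₁ uv = up-to-reversal
      (same-order p z q o≡ (ap ∼-refl ∼-refl) t≡u t≡v uv)
      ∼-refl (inj₁ ∼-refl) (inj₂ ∼-refl)
    ... | inj₂ vu = up-to-reversal
      (swapped-order p z q o≡ (apart-sym (ap ∼-refl ∼-refl)) t≡u t≡v vu)
      ∼-refl (inj₁ ∼-refl) (inj₂ ∼-refl)
    from-infix {t} u∈t (inj₂ v′∈t)
      with a , b , t≡u ← infix⁻ u∈t
         | c , d , t≡v′ ← infix⁻ (subst (λ x → Infix _≡_ x t) (reverse-++ z q) v′∈t)
      with apart-ordered a b c d (ap ∼-refl v′∼v) (trans (sym t≡u) t≡v′)
    ... | inj₁ uv′ = up-to-reversal
      (reversed-order p z q o≡ refl (ap ∼-refl v′∼v) t≡u t≡v′ uv′)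
      ∼-refl (inj₁ ∼-refl) (inj₂ v′∼v)
    -- `vᴿ = qᴿ zᴿ` now comes first, followed by `u`, the reversal of `zᴿ pᴿ`. This is the reversed
    -- position for the pair `(vᴿ, uᴿ)`, whose merge `qᴿ zᴿ pᴿ` is the reversal of `p z q`.
    ... | inj₂ v′u = up-to-reversal
      (reversed-order (reverse q) (reverse z) (reverse p) (trans o≡ (sym (length-reverse z))) u≡
        (apart-sym (ap ∼-refl v′∼v)) t≡v′ t≡u v′u)
      m′∼m (inj₂ v′∼v) (inj₁ ∼-refl)

    by-orientation : ∀ {t} → Contains (p ++ z) t → Contains (z ++ q) t →
                     SuperstringMerging o t (p ++ z ++ q) (p ++ z) (z ++ q)
    by-orientation (inj₁ u∈t) v∈t = from-infix u∈t v∈t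
    by-orientation {t} (inj₂ u′∈t) v∈t = record
      { result     = result
      ; result-len = trans result-len (cong (_+ o) (length-reverse t))
      ; merged     = merged
      ; kept       = λ ap s∈t → kept ap (contains-reverse s∈t)
      }
      where
      open SuperstringMerging (from-infix
        (subst (λ x → Infix _≡_ x (reverse t)) (reverse-involutive (p ++ z)) (infix-reverse u′∈t))
        (contains-reverse v∈t))

-- Overlaps, and what the greedy choice guarantees.

module _ {A : Set} (_≟_ : DecidableEquality A) where
  open Strings _≟_
  open DecMembership _≟ˢ_ using (_∈_; _∉_; _∈?_; _∉?_)

  ov-split : ∀ x y → ∃[ p ] ∃[ z ] ∃[ q ] x ≡ p ++ z × y ≡ z ++ q × ov x y ≡ length z
  ov-split []      y = [] , [] , y , refl , refl , refl
  ov-split (a ∷ x) y with prefix? _≟_ (a ∷ x) y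
  ... | yes x≼y with x≋ Prefix.++ q ← Prefix.toView x≼y
      = [] , a ∷ x , q , refl , cong (_++ q) (sym (Pointwise-≡⇒≡ x≋)) , refl
  ... | no _ with p , z , q , x≡ , y≡ , ov≡ ← ov-split x y
      = a ∷ p , z , q , cong (a ∷_) x≡ , y≡ , ov≡

  -- `ov` tries the suffixes of `x` from the longest down. A hit is at least as long as any overlap
  -- still possible; a miss rules out `p = []`.
  ov-maximal : ∀ x y → OverlapsBoundedBy (ov x y) x y
  ov-maximal []      y []      z q refl refl = z≤n
  ov-maximal (a ∷ x) y p z q x≡ y≡ with prefix? _≟_ (a ∷ x) y
  ... | yes _ = subst (length z ≤_) (cong length (sym x≡)) (length-++-≤ʳ z {p})
  ov-maximal (a ∷ x) y []      z q refl refl | no x⋠y =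
    contradiction (Prefix.fromView (Pointwise.refl refl Prefix.++ q)) x⋠y
  ov-maximal (a ∷ x) y (_ ∷ p) z q refl refl | no _ = ov-maximal x y p z q refl refl

  ⊗-split : ∀ p z q → ov (p ++ z) (z ++ q) ≡ length z → (p ++ z) ⊗ (z ++ q) ≡ p ++ z ++ q
  ⊗-split p z q ov≡ = cong (_++ z ++ q) (begin
    take (length (p ++ z) ∸ ov (p ++ z) (z ++ q)) (p ++ z)
      ≡⟨ cong₂ (λ m n → take (m ∸ n) (p ++ z)) (length-++ p) ov≡ ⟩
    take (length p + length z ∸ length z) (p ++ z)
      ≡⟨ cong (λ n → take n (p ++ z)) (m+n∸n≡m (length p) (length z)) ⟩
    take (length p) (p ++ z)
      ≡⟨ take-length-++ p ⟩
    p ∎)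
    where
    open ≡-Reasoning
    take-length-++ : ∀ (p : String) {z} → take (length p) (p ++ z) ≡ p
    take-length-++ []      = refl
    take-length-++ (a ∷ p) = cong (a ∷_) (take-length-++ p)

  length-⊗ : ∀ u v → length (u ⊗ v) + ov u v ≡ length u + length v
  length-⊗ u v with p , z , q , refl , refl , ov≡ ← ov-split u v = begin
    length ((p ++ z) ⊗ (z ++ q)) + ov (p ++ z) (z ++ q)
      ≡⟨ cong₂ (λ w n → length w + n) (⊗-split p z q ov≡) ov≡ ⟩
    length (p ++ z ++ q) + length z
      ≡⟨ cong (_+ length z) (trans (length-++ p) (cong (λ n → length p + n) (length-++ z))) ⟩
    length p + (length z + length q) + length z
      ≡⟨ rearrange (length p) (length z) (length q) ⟩
    (length p + length z) + (length z + length q)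
      ≡⟨ cong₂ _+_ (length-++ p) (length-++ z) ⟨
    length (p ++ z) + length (z ++ q) ∎
    where
    open ≡-Reasoning
    rearrange : ∀ p z q → p + (z + q) + z ≡ (p + z) + (z + q)
    rearrange = solve-∀

  tilde⁻ : ∀ S {x} → x ∈ tilde S → ∃[ x₀ ] x₀ ∈ S × x₀ ∼ x
  tilde⁻ S {x} x∈ with ∈-++⁻ S x∈
  ... | inj₁ x∈S = x , x∈S , ∼-refl
  ... | inj₂ x∈Sᴿ with x₀ , x₀∈S , x≡ ← ∈-map⁻ reverse x∈Sᴿ = x₀ , x₀∈S , ∼-sym (inj₂ x≡)

  tilde⁺ : ∀ {S x x₀} → x₀ ∈ S → x ∼ x₀ → x ∈ tilde S
  tilde⁺ x₀∈S (inj₁ refl)     = ∈-++⁺ˡ x₀∈S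
  tilde⁺ {S} x₀∈S (inj₂ refl) = ∈-++⁺ʳ S (∈-map⁺ reverse x₀∈S)

  tilde-∼ : ∀ S {x y} → x ∈ tilde S → y ∼ x → y ∈ tilde S
  tilde-∼ S x∈ y∼x with x₀ , x₀∈S , x₀∼x ← tilde⁻ S x∈ = tilde⁺ x₀∈S (∼-trans y∼x (∼-sym x₀∼x))

  ∈-reversals⁺ : ∀ {u v} → u ∼ v → u ∈ (v ∷ reverse v ∷ [])
  ∈-reversals⁺ (inj₁ u≡v) = here u≡v
  ∈-reversals⁺ (inj₂ u≡v) = there (here u≡v)

  ∉-reversals : ∀ {u v} → ¬ u ∼ v → u ∉ (v ∷ reverse v ∷ [])
  ∉-reversals u≁v (here u≡v)         = u≁v (inj₁ u≡v)
  ∉-reversals u≁v (there (here u≡v)) = u≁v (inj₂ u≡v)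

  contains⇒factorUpToReversal : ∀ {x y} → Contains x y → FactorUpToReversal x y
  contains⇒factorUpToReversal (inj₁ i)         = inj₁ i
  contains⇒factorUpToReversal {x} {y} (inj₂ i) =
    inj₂ (subst (λ w → Factor w (reverse y)) (reverse-involutive x) (infix-reverse i))

  factorUpToReversal⇒contains : ∀ {x y} → FactorUpToReversal x y → Contains x y
  factorUpToReversal⇒contains (inj₁ i)         = inj₁ i
  factorUpToReversal⇒contains {x} {y} (inj₂ i) = inj₂ (subst (Factor (reverse x)) (reverse-involutive y) (infix-reverse i))

  factor-∼ : ∀ {x y x₀ y₀} → x₀ ∼ x → y₀ ∼ y → Factor x y → FactorUpToReversal x₀ y₀
  factor-∼ x₀∼x y₀∼y i = contains⇒factorUpToReversal (contains-in-∼ (∼-sym y₀∼y) (contains-∼ (∼-sym x₀∼x) (inj₁ i)))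

  tilde-factor-free : ∀ {S} → ReverseFactorFree S → ∀ {x y} → x ∈ tilde S → y ∈ tilde S →
                      ¬ x ∼ y → ¬ Factor x y
  tilde-factor-free {S} rff x∈ y∈ x≁y i
    with x₀ , x₀∈S , x₀∼x ← tilde⁻ S x∈ | y₀ , y₀∈S , y₀∼y ← tilde⁻ S y∈ =
    rff x₀∈S y₀∈S (λ { refl → x≁y (∼-trans (∼-sym x₀∼x) y₀∼y) }) (factor-∼ x₀∼x y₀∼y i)

  -- Two members of `tilde S` not equal up to reversal form a candidate in either order, so the
  -- greedy choice bounds both overlaps.
  maximal⇒apart : ∀ {S u v} → ReverseFactorFree S → MaximalCandidate S u v →
    ∀ {x y} → x ∈ tilde S → y ∈ tilde S → ¬ x ∼ y → Apart (ov u v) x y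
  maximal⇒apart {S} {u} {v} rff (_ , max) {x} {y} x∈ y∈ x≁y = record
    { ⋢   = tilde-factor-free rff x∈ y∈ x≁y
    ; ⋣   = tilde-factor-free rff y∈ x∈ y≁x
    ; ov≤ = bounded x∈ y∈ x≁y
    ; ≥vo = bounded y∈ x∈ y≁x
    }
    where
    y≁x : ¬ y ∼ x
    y≁x y∼x = x≁y (∼-sym y∼x)
    bounded : ∀ {x y} → x ∈ tilde S → y ∈ tilde S → ¬ x ∼ y → OverlapsBoundedBy (ov u v) x y
    bounded {x} {y} x∈ y∈ x≁y p z q x≡ y≡ =
      ≤-trans (ov-maximal x y p z q x≡ y≡) (max (x∈ , y∈ , ∉-reversals x≁y))

  -- Effect of a merge on superstrings and on reverse-factor-freeness.

  removed : String → String → List String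
  removed u v = u ∷ v ∷ reverse u ∷ reverse v ∷ []

  ∈-insert⁻ : ∀ {s} w S → s ∈ insert w S → s ≡ w ⊎ s ∈ S
  ∈-insert⁻ w S s∈ with w ∈? S
  ... | yes _ = inj₂ s∈
  ∈-insert⁻ w S (here s≡w)  | no _ = inj₁ s≡w
  ∈-insert⁻ w S (there s∈S) | no _ = inj₂ s∈S

  ∈-merge⁻ : ∀ S u v {s} → s ∈ merge S u v → (s ≡ u ⊗ v ⊎ s ∈ S) × ¬ s ∼ u × ¬ s ∼ v
  ∈-merge⁻ S u v s∈ with s∈′ , s∉ ← ∈-filter⁻ (_∉? removed u v) {xs = insert (u ⊗ v) S} s∈ =
    ∈-insert⁻ (u ⊗ v) S s∈′
    , (λ { (inj₁ eq) → s∉ (here eq) ; (inj₂ eq) → s∉ (there (there (here eq))) })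
    , (λ { (inj₁ eq) → s∉ (there (here eq)) ; (inj₂ eq) → s∉ (there (there (there (here eq)))) })

  candidate≁ : ∀ {S u v} → Candidate S u v → ¬ u ∼ v
  candidate≁ (_ , _ , u∉) u∼v = u∉ (∈-reversals⁺ u∼v)

  -- A member of the new set is either `u ⊗ v`, present by construction, or a survivor equal to
  -- neither `u` nor `v` up to reversal. Such a survivor is apart from every orientation of both, so
  -- it is kept.
  merge-superstring : ∀ {S u v t} → ReverseFactorFree S → MaximalCandidate S u v →
    CommonSuperstringWithReversals S t →
    ∃[ t′ ] CommonSuperstringWithReversals (merge S u v) t′ × length t′ ≡ length t + ov u v
  merge-superstring {S} {u} {v} {t} rff mc@(cand@(u∈ , v∈ , _) , _) csr
    with p , z , q , refl , refl , ov≡ ← ov-split u v = result , csr′ , result-len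
    where
    contained : ∀ {x} → x ∈ tilde S → Contains x t
    contained x∈ with x₀ , x₀∈S , x₀∼x ← tilde⁻ S x∈ = contains-∼ x₀∼x (csr x₀∈S)
    apart : ∀ {x y} → x ∈ tilde S → y ∈ tilde S → ¬ x ∼ y → Apart (ov u v) x y
    apart = maximal⇒apart rff mc
    open SuperstringMerging (merge-in-superstring p z q ov≡
      (λ x∼u y∼v → apart (tilde-∼ S u∈ x∼u) (tilde-∼ S v∈ y∼v)
        (λ x∼y → candidate≁ {S} cand (∼-trans (∼-sym x∼u) (∼-trans x∼y y∼v))))
      (contained u∈) (contained v∈))
    csr′ : CommonSuperstringWithReversals (merge S u v) result
    csr′ s∈ with ∈-merge⁻ S u v s∈
    ... | inj₁ refl , _ , _ = subst (λ w → Contains w result) (sym (⊗-split p z q ov≡)) merged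
    ... | inj₂ s∈S , s≁u , s≁v = kept
      (λ { x∼s (inj₁ y∼u) → apart (tilde⁺ s∈S x∼s) (tilde-∼ S u∈ y∼u)
             (λ x∼y → s≁u (∼-trans (∼-sym x∼s) (∼-trans x∼y y∼u)))
         ; x∼s (inj₂ y∼v) → apart (tilde⁺ s∈S x∼s) (tilde-∼ S v∈ y∼v)
             (λ x∼y → s≁v (∼-trans (∼-sym x∼s) (∼-trans x∼y y∼v))) })
      (csr s∈S)

  -- A factor of u ⊗ v that lies neither in u nor in v would overlap both by
  -- more than ov u v.
  ⋢-⊗ : ∀ {S u v x} → ReverseFactorFree S → MaximalCandidate S u v →
        x ∈ tilde S → ¬ x ∼ u → ¬ x ∼ v → ¬ Factor x (u ⊗ v)
  ⋢-⊗ {S} {u} {v} {x} rff mc@((u∈ , v∈ , _) , _) x∈ x≁u x≁v x⊑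
    with p , z , q , refl , refl , ov≡ ← ov-split u v
    with l , r , eq ← infix⁻ (subst (Factor x) (⊗-split p z q ov≡) x⊑) =
    by-position (apart-ordered l r [] q x-u (trans (sym eq) (sym (++-assoc p z q))))
                (apart-ordered l r p [] x-v (trans (sym eq) (cong (p ++_) (sym (++-identityʳ (z ++ q))))))
    where
    x-u : Apart (ov (p ++ z) (z ++ q)) x (p ++ z)
    x-u = maximal⇒apart rff mc x∈ u∈ x≁u
    x-v : Apart (ov (p ++ z) (z ++ q)) x (z ++ q)
    x-v = maximal⇒apart rff mc x∈ v∈ x≁v
    by-position : Before l x r [] (p ++ z) q ⊎ Before [] (p ++ z) q l x r →
                  Before l x r p (z ++ q) [] ⊎ Before p (z ++ q) [] l x r → ⊥
    by-position (inj₁ xu) _         = Apart.⋢ x-u (before-prefix xu)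
    by-position (inj₂ _)  (inj₂ vx) =
      Apart.⋢ x-v (subst (Factor x) (++-identityʳ (z ++ q)) (before-suffix vx))
    -- `x` starts no earlier than the end of `p`, by the overlap bound with `u`, and no later, since
    -- `v` starts there. So `x` is a prefix of `v`.
    by-position (inj₂ ux) (inj₁ (before {e} {f} p≡ _ mid))
      with h , refl ← before-start p z refl ux (Apart.≥vo x-u) (≤-reflexive ov≡) =
      Apart.⋢ x-v (infix⁺ [] f (trans (cong (_++ z ++ q) (sym e≡[])) (sym mid)))
      where
      he≡[] : h ++ e ≡ []
      he≡[] = ++-cancelˡ p _ _ (trans (sym (++-assoc p h e)) (trans (sym p≡) (sym (++-identityʳ p))))
      e≡[] : e ≡ []
      e≡[] = ++-conicalʳ h e he≡[]

  left-⊑-⊗ : ∀ u v → Factor u (u ⊗ v)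
  left-⊑-⊗ u v with p , z , q , refl , refl , ov≡ ← ov-split u v =
    infix⁺ [] q (trans (⊗-split p z q ov≡) (sym (++-assoc p z q)))

  -- Lets the argument for one step be repeated along the run. A survivor inside `u ⊗ v` is excluded
  -- by `⋢-⊗`; if `u ⊗ v` were inside a survivor or its reversal, so would be `u`.
  merge-rff : ∀ {S u v} → ReverseFactorFree S → MaximalCandidate S u v →
              ReverseFactorFree (merge S u v)
  merge-rff {S} {u} {v} rff mc@((u∈ , v∈ , _) , _) x∈ y∈ x≢y x⊑y
    with ∈-merge⁻ S u v x∈ | ∈-merge⁻ S u v y∈
  ... | inj₂ x∈S , _ | inj₂ y∈S , _ = rff x∈S y∈S x≢y x⊑y
  ... | inj₁ refl , _ | inj₁ refl , _ = x≢y refl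
  ... | inj₂ x∈S , x≁u , x≁v | inj₁ refl , _ = x⋢ (factorUpToReversal⇒contains x⊑y)
    where
    x⋢ : ¬ Contains _ (u ⊗ v)
    x⋢ (inj₁ i) = ⋢-⊗ rff mc (tilde⁺ x∈S ∼-refl) x≁u x≁v i
    x⋢ (inj₂ i) = ⋢-⊗ rff mc (tilde⁺ x∈S (reverse-∼ _))
      (λ xᴿ∼u → x≁u (∼-trans (∼-sym (reverse-∼ _)) xᴿ∼u))
      (λ xᴿ∼v → x≁v (∼-trans (∼-sym (reverse-∼ _)) xᴿ∼v)) i
  ... | inj₁ refl , _ | inj₂ y∈S , y≁u , y≁v = ⊗⋢ x⊑y
    where
    u⋢ : ∀ {y} → y ∈ tilde S → ¬ u ∼ y → ¬ Factor (u ⊗ v) y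
    u⋢ y∈ u≁y i = tilde-factor-free rff u∈ y∈ u≁y (Infix.trans trans (left-⊑-⊗ u v) i)
    ⊗⋢ : ¬ FactorUpToReversal (u ⊗ v) _
    ⊗⋢ (inj₁ i) = u⋢ (tilde⁺ y∈S ∼-refl) (λ u∼y → y≁u (∼-sym u∼y)) i
    ⊗⋢ (inj₂ i) = u⋢ (tilde⁺ y∈S (reverse-∼ _))
      (λ u∼yᴿ → y≁u (∼-trans (∼-sym (reverse-∼ _)) (∼-sym u∼yᴿ))) i

  -- Total length under a merge.

  module _ {P : String → Set} (P? : ∀ x → Dec (P x)) where

    totalLength-filter : ∀ S → totalLength (filter P? S) ≤ totalLength S
    totalLength-filter []      = z≤n
    totalLength-filter (y ∷ S) with P? y
    ... | yes _ = +-monoʳ-≤ (length y) (totalLength-filter S)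
    ... | no _  = m≤n⇒m≤o+n (length y) (totalLength-filter S)

    totalLength-filter-one : ∀ {x} S → x ∈ S → ¬ P x →
      length x + totalLength (filter P? S) ≤ totalLength S
    totalLength-filter-one {x} (y ∷ S) x∈ ¬Px with P? y | x∈
    ... | yes Py | here refl = contradiction Py ¬Px
    ... | no _   | here refl = +-monoʳ-≤ (length y) (totalLength-filter S)
    ... | yes _  | there x∈S = subst (_≤ length y + totalLength S)
      (swap (length y) (length x) (totalLength (filter P? S))) (+-monoʳ-≤ (length y) (totalLength-filter-one S x∈S ¬Px))
      where
      swap : ∀ a b c → a + (b + c) ≡ b + (a + c)
      swap = solve-∀
    ... | no _   | there x∈S = m≤n⇒m≤o+n (length y) (totalLength-filter-one S x∈S ¬Px)

    -- Distinct strings occupy different positions of the list, so both lengths are saved.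
    totalLength-filter-two : ∀ {x x′} S → x ≢ x′ → x ∈ S → x′ ∈ S → ¬ P x → ¬ P x′ →
      length x + length x′ + totalLength (filter P? S) ≤ totalLength S
    totalLength-filter-two {x} {x′} (y ∷ S) x≢x′ x∈ x′∈ ¬Px ¬Px′ with P? y | x∈ | x′∈
    ... | _      | here refl | here refl  = contradiction refl x≢x′
    ... | yes Py | here refl | there x′∈S = contradiction Py ¬Px
    ... | yes Py | there x∈S | here refl  = contradiction Py ¬Px′
    ... | no _   | here refl | there x′∈S = subst (_≤ length y + totalLength S)
      (sym (+-assoc (length y) _ _)) (+-monoʳ-≤ (length y) (totalLength-filter-one S x′∈S ¬Px′))
    ... | no _   | there x∈S | here refl  = subst (_≤ length y + totalLength S)
      (swap (length y) (length x) (totalLength (filter P? S))) (+-monoʳ-≤ (length y) (totalLength-filter-one S x∈S ¬Px))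
      where
      swap : ∀ a b c → a + (b + c) ≡ b + a + c
      swap = solve-∀
    ... | yes _  | there x∈S | there x′∈S = subst (_≤ length y + totalLength S)
      (swap (length y) (length x) (length x′) (totalLength (filter P? S))) (+-monoʳ-≤ (length y) (totalLength-filter-two S x≢x′ x∈S x′∈S ¬Px ¬Px′))
      where
      swap : ∀ a b c d → a + (b + c + d) ≡ b + c + (a + d)
      swap = solve-∀
    ... | no _   | there x∈S | there x′∈S =
      m≤n⇒m≤o+n (length y) (totalLength-filter-two S x≢x′ x∈S x′∈S ¬Px ¬Px′)

    totalLength-filter-insert : ∀ w S →
      totalLength (filter P? (insert w S)) ≤ length w + totalLength (filter P? S)
    totalLength-filter-insert w S with w ∈? S
    ... | yes _ = m≤n+m _ (length w)
    ... | no _ with P? w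
    ...   | yes _ = ≤-refl
    ...   | no _  = m≤n+m _ (length w)

  ∈-removed : ∀ {x u v} → x ∼ u ⊎ x ∼ v → x ∈ removed u v
  ∈-removed (inj₁ (inj₁ x≡)) = here x≡
  ∈-removed (inj₁ (inj₂ x≡)) = there (there (here x≡))
  ∈-removed (inj₂ (inj₁ x≡)) = there (here x≡)
  ∈-removed (inj₂ (inj₂ x≡)) = there (there (there (here x≡)))

  -- The set itself holds `u₀` and `v₀`, equal to `u` and `v` up to reversal. They have the same
  -- lengths, are distinct because `u` and `v` are not equal up to reversal, and are both removed;
  -- the new string costs `|u| + |v|` minus the overlap.
  merge-totalLength : ∀ {S u v} → Candidate S u v →
                      totalLength (merge S u v) + ov u v ≤ totalLength S
  merge-totalLength {S} {u} {v} cand@(u∈ , v∈ , _)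
    with u₀ , u₀∈S , u₀∼u ← tilde⁻ S u∈ | v₀ , v₀∈S , v₀∼v ← tilde⁻ S v∈ = begin
    totalLength (merge S u v) + ov u v
      ≤⟨ +-monoˡ-≤ (ov u v) (totalLength-filter-insert P? (u ⊗ v) S) ⟩
    length (u ⊗ v) + totalLength (filter P? S) + ov u v
      ≡⟨ swap (length (u ⊗ v)) _ _ ⟩
    length (u ⊗ v) + ov u v + totalLength (filter P? S)
      ≡⟨ cong (_+ totalLength (filter P? S)) (length-⊗ u v) ⟩
    length u + length v + totalLength (filter P? S)
      ≡⟨ cong₂ (λ m n → m + n + totalLength (filter P? S)) (length-∼ u₀∼u) (length-∼ v₀∼v) ⟨
    length u₀ + length v₀ + totalLength (filter P? S)
      ≤⟨ totalLength-filter-two P? S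
           (λ { refl → candidate≁ {S} cand (∼-trans (∼-sym u₀∼u) v₀∼v) }) u₀∈S v₀∈S
           (λ u₀∉ → u₀∉ (∈-removed (inj₁ u₀∼u))) (λ v₀∉ → v₀∉ (∈-removed (inj₂ v₀∼v))) ⟩
    totalLength S ∎
    where
    open ≤-Reasoning
    P? : ∀ x → Dec (x ∉ removed u v)
    P? = _∉? removed u v
    swap : ∀ a b c → a + b + c ≡ a + c + b
    swap = solve-∀

  -- The bound along a whole run.

  -- Induction on the run with `t` arbitrary, since each step replaces `t` by a longer or equally
  -- long word. At the end `w` or its reversal is a factor of `t`, so both summands on the right are
  -- at least `|w|`.
  greedy-bound : ∀ {S w t} → ReverseFactorFree S → Star _⟶ᵍ_ S [ w ] →
    CommonSuperstringWithReversals S t → length w + length w ≤ length t + totalLength S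
  greedy-bound {w = w} {t} _ ε csr = +-mono-≤ (w≤t (csr (here refl))) (m≤m+n (length w) 0)
    where
    w≤t : Contains w t → length w ≤ length t
    w≤t (inj₁ i) = Infix.length-mono i
    w≤t (inj₂ i) = subst (_≤ length t) (length-reverse w) (Infix.length-mono i)
  greedy-bound {S} {w} {t} rff (greedy {u} {v} _ mc@(cand , _) ◅ run) csr
    with t′ , csr′ , |t′| ← merge-superstring rff mc csr = begin
    length w + length w                             ≤⟨ greedy-bound (merge-rff rff mc) run csr′ ⟩
    length t′ + totalLength (merge S u v)           ≡⟨ cong (_+ totalLength (merge S u v)) |t′| ⟩
    length t + ov u v + totalLength (merge S u v)   ≡⟨ swap (length t) _ _ ⟩
    length t + (totalLength (merge S u v) + ov u v) ≤⟨ +-monoʳ-≤ (length t) (merge-totalLength {S} cand) ⟩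
    length t + totalLength S ∎
    where
    open ≤-Reasoning
    swap : ∀ a b c → a + b + c ≡ a + (c + b)
    swap = solve-∀

  makeReverseFactorFree-id : ∀ {S T} → ReverseFactorFree S → MakeReverseFactorFree S T → S ≡ T
  makeReverseFactorFree-id _   (ε , _) = refl
  makeReverseFactorFree-id rff (remove x∈ y∈ y≢x x⊑y ◅ _ , _) =
    contradiction x⊑y (rff x∈ y∈ (λ x≡y → y≢x (sym x≡y)))

-- Passage to rational numbers.

toℚᵘ-homo-- : ∀ p q → toℚᵘ (p - q) ℚᵘ.≃ toℚᵘ p ℚᵘ.- toℚᵘ q
toℚᵘ-homo-- p q = ℚᵘ.≃-trans (toℚᵘ-homo-+ p (ℚ.- q))
  (ℚᵘ.+-congʳ (toℚᵘ p) (toℚᵘ-homo‿- q))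

half-compression : ∀ n w k → w + w ≤ k + n →
  fromℤ (+ n) - fromℤ (+ w) ≥ ½ * (fromℤ (+ n) - fromℤ (+ k))
half-compression n w k ww≤kn = toℚᵘ-cancel-≤ (begin
  toℚᵘ (½ * (fromℤ (+ n) - fromℤ (+ k)))
    ≃⟨ toℚᵘ-homo-* ½ (fromℤ (+ n) - fromℤ (+ k)) ⟩
  toℚᵘ ½ ℚᵘ.* toℚᵘ (fromℤ (+ n) - fromℤ (+ k))
    ≃⟨ ℚᵘ.*-congˡ {toℚᵘ ½} (toℚᵘ-homo-- (fromℤ (+ n)) (fromℤ (+ k))) ⟩
  toℚᵘ ½ ℚᵘ.* (toℚᵘ (fromℤ (+ n)) ℚᵘ.- toℚᵘ (fromℤ (+ k)))
    ≤⟨ ℚᵘ.*≤* (ℤ.0≤i-j⇒j≤i 0≤difference) ⟩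
  toℚᵘ (fromℤ (+ n)) ℚᵘ.- toℚᵘ (fromℤ (+ w))
    ≃⟨ toℚᵘ-homo-- (fromℤ (+ n)) (fromℤ (+ w)) ⟨
  toℚᵘ (fromℤ (+ n) - fromℤ (+ w)) ∎)
  where
  open ℚᵘ.≤-Reasoning
  -- The left side is the cross-multiplied form of the inequality between unnormalised fractions,
  -- with denominators 1 and 2 written out.
  difference : ∀ n w k →
    (n ℤ.* + 1 ℤ.+ ℤ.- w ℤ.* + 1) ℤ.* + 2 ℤ.- (+ 1 ℤ.* (n ℤ.* + 1 ℤ.+ ℤ.- k ℤ.* + 1)) ℤ.* + 1
      ≡ (k ℤ.+ n) ℤ.- (w ℤ.+ w)
  difference = ℤ-solver.solve-∀
  0≤difference : + 0 ℤ.≤ _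
  0≤difference = subst (+ 0 ℤ.≤_) (sym (difference (+ n) (+ w) (+ k)))
    (ℤ.i≤j⇒0≤j-i (ℤ.+≤+ ww≤kn))

theorem2 : {A : Set} (_≟_ : DecidableEquality A) → let open Strings _≟_ in
    (S : List String) → Unique S → S ≢ [] → ReverseFactorFree S →
    (n : ℕ) → n ≡ totalLength S →
    (k-min : ℕ) → IsShortestLength S k-min →
    (w : String) → GreedyR S w →
    fromℤ (+ n) - fromℤ (+ length w) ≥ ½ * (fromℤ (+ n) - fromℤ (+ k-min))
theorem2 _≟_ S _ _ rff n refl k-min ((t , csr , refl) , _) w (T , mrff , run)
  -- The first phase leaves `S` unchanged, so the run starts from `S`, with a shortest superstring
  -- as `t`.
  with refl ← makeReverseFactorFree-id _≟_ rff mrff =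
  half-compression n (length w) k-min (greedy-bound _≟_ rff run csr)
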